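{- Let $\mathbb{K}$ be a field and $f=a_0(x)+a_1(x)y+\cdots+a_n(x)y^n\in\mathbb{K}[x,y]$ with $n\geq 2$, $a_0,\ldots,a_n\in\mathbb{K}[x]$, $a_0a_n\neq 0$. Assume that $f$ has no nonconstant factor in $\mathbb{K}[x]$. If there exists an index $j$ with $1\leq j\leq n-1$ such that $$\deg a_j>\max_{i<j}\{\deg a_i+(j-i)\deg a_n\}\quad\text{and}\quad \deg a_j>\max_{i>j}\{\deg a_i+(i-j)\deg a_0\},$$ then $f$ is a product of at most $\min\{j,n-j\}$ irreducible polynomials over $\mathbb{K}[x]$. In particular, if $j=1$ or $j=n-1$, then $f$ is irreducible over $\mathbb{K}[x]$.
   Context: Indices $i$ range over $\{0,1,\ldots,n\}$. $f$ is regarded as a polynomial in $y$ with coefficients in $\mathbb{K}[x]$; "a product of at most $k$ irreducible polynomials over $\mathbb{K}[x]$" means that in the factorization of $f$ into irreducible elements of $\mathbb{K}[x][y]$ the number of factors, counted with multiplicities, is at most $k$. -}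

module Defs where

open import Level using (Level; _⊔_; Lift; lift; lower)
open import Algebra.Bundles using (CommutativeRing)
open import Algebra.Apartness.Bundles using (HeytingField; HeytingCommutativeRing)
open import Axiom.ExcludedMiddle using (ExcludedMiddle)
open import Data.Fin.Base using (Fin)
open import Data.List.Base using (List; []; _∷_; map; foldr; length; tabulate)
open import Data.List.Relation.Unary.All using (All)
import Data.Maybe.Base as Maybe
open import Data.Nat.Base as ℕ using (ℕ; zero; suc)
open import Data.Product.Base using (Σ-syntax; _×_; _,_)
open import Relation.Binary.Definitions using (Decidable)
open import Relation.Nullary.Construct.Add.Infimum using (_₋; ⊥₋; [_])
open import Relation.Nullary.Decidable using (yes; no; map′)
import Relation.Binary.Construct.Add.Infimum.Strict as Strict
import Algebra.Properties.Semiring.Primality as Primality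
import Algebra.Properties.Semiring.Divisibility as Divisibility

private
  variable
    c ℓ ℓ₁ ℓ₂ : Level

-- Univariate polynomials: the list a₀ ∷ a₁ ∷ … ∷ aₙ ∷ [] stands for
-- a₀ + a₁X + ⋯ + aₙXⁿ.  Trailing zeros are allowed, so polynomials are
-- compared coefficientwise.

module Polynomial (R : CommutativeRing c ℓ) where

  open CommutativeRing R
  open import Algebra.Properties.Ring ring using (-0#≈0#)
  open import Algebra.Properties.CommutativeSemigroup +-commutativeSemigroup
    using (interchange; x∙yz≈y∙xz)
  open import Relation.Binary.Reasoning.Setoid setoid

  Poly : Set _
  Poly = List Carrier

  coeff : Poly → ℕ → Carrier
  coeff []      _       = 0#
  coeff (a ∷ p) zero    = a
  coeff (a ∷ p) (suc k) = coeff p k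

  infix 4 _≈ₚ_

  record _≈ₚ_ (p q : Poly) : Set ℓ where
    constructor coeffwise
    field at : ∀ k → coeff p k ≈ coeff q k

  open _≈ₚ_ public

  const : Carrier → Poly
  const a = a ∷ []

  infixl 6 _+ₚ_
  infixl 7 _*ₚ_ _·_
  infix  8 -ₚ_

  _+ₚ_ : Poly → Poly → Poly
  []      +ₚ q       = q
  (a ∷ p) +ₚ []      = a ∷ p
  (a ∷ p) +ₚ (b ∷ q) = (a + b) ∷ (p +ₚ q)

  -ₚ_ : Poly → Poly
  -ₚ_ = map (-_)

  _·_ : Carrier → Poly → Poly
  a · p = map (a *_) p

  _*ₚ_ : Poly → Poly → Poly
  []      *ₚ q = []
  (a ∷ p) *ₚ q = a · q +ₚ (0# ∷ p *ₚ q)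

  coeff-+ : ∀ p q k → coeff (p +ₚ q) k ≈ coeff p k + coeff q k
  coeff-+ []      q       k       = sym (+-identityˡ _)
  coeff-+ (a ∷ p) []      k       = sym (+-identityʳ _)
  coeff-+ (a ∷ p) (b ∷ q) zero    = refl
  coeff-+ (a ∷ p) (b ∷ q) (suc k) = coeff-+ p q k

  coeff-neg : ∀ p k → coeff (-ₚ p) k ≈ - coeff p k
  coeff-neg []      k       = sym -0#≈0#
  coeff-neg (a ∷ p) zero    = refl
  coeff-neg (a ∷ p) (suc k) = coeff-neg p k

  coeff-· : ∀ a p k → coeff (a · p) k ≈ a * coeff p k
  coeff-· a []      k       = sym (zeroʳ a)
  coeff-· a (b ∷ p) zero    = refl
  coeff-· a (b ∷ p) (suc k) = coeff-· a p k

  ≈ₚ-refl : ∀ {p} → p ≈ₚ p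
  ≈ₚ-refl .at k = refl

  ≈ₚ-sym : ∀ {p q} → p ≈ₚ q → q ≈ₚ p
  ≈ₚ-sym e .at k = sym (e .at k)

  ≈ₚ-trans : ∀ {p q r} → p ≈ₚ q → q ≈ₚ r → p ≈ₚ r
  ≈ₚ-trans e f .at k = trans (e .at k) (f .at k)

  ∷-cong : ∀ {a b p q} → a ≈ b → p ≈ₚ q → (a ∷ p) ≈ₚ (b ∷ q)
  ∷-cong e f .at zero    = e
  ∷-cong e f .at (suc k) = f .at k

  tail-≈ : ∀ {a b p q} → (a ∷ p) ≈ₚ (b ∷ q) → p ≈ₚ q
  tail-≈ e .at k = e .at (suc k)

  0∷[] : ∀ {p} → p ≈ₚ [] → (0# ∷ p) ≈ₚ []
  0∷[] e .at zero    = refl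
  0∷[] e .at (suc k) = e .at k

  +ₚ-cong : ∀ {p p′ q q′} → p ≈ₚ p′ → q ≈ₚ q′ → p +ₚ q ≈ₚ p′ +ₚ q′
  +ₚ-cong {p} {p′} {q} {q′} e f .at k = begin
    coeff (p +ₚ q) k          ≈⟨ coeff-+ p q k ⟩
    coeff p k + coeff q k     ≈⟨ +-cong (e .at k) (f .at k) ⟩
    coeff p′ k + coeff q′ k   ≈⟨ coeff-+ p′ q′ k ⟨
    coeff (p′ +ₚ q′) k        ∎

  -ₚ-cong : ∀ {p q} → p ≈ₚ q → -ₚ p ≈ₚ -ₚ q
  -ₚ-cong {p} {q} e .at k =
    trans (coeff-neg p k) (trans (-‿cong (e .at k)) (sym (coeff-neg q k)))

  ·-cong : ∀ {a b p q} → a ≈ b → p ≈ₚ q → a · p ≈ₚ b · q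
  ·-cong {a} {b} {p} {q} e f .at k =
    trans (coeff-· a p k) (trans (*-cong e (f .at k)) (sym (coeff-· b q k)))

  +ₚ-comm : ∀ p q → p +ₚ q ≈ₚ q +ₚ p
  +ₚ-comm p q .at k =
    trans (coeff-+ p q k) (trans (+-comm _ _) (sym (coeff-+ q p k)))

  +ₚ-assoc : ∀ p q r → (p +ₚ q) +ₚ r ≈ₚ p +ₚ (q +ₚ r)
  +ₚ-assoc p q r .at k = begin
    coeff ((p +ₚ q) +ₚ r) k                ≈⟨ coeff-+ (p +ₚ q) r k ⟩
    coeff (p +ₚ q) k + coeff r k           ≈⟨ +-congʳ (coeff-+ p q k) ⟩
    coeff p k + coeff q k + coeff r k      ≈⟨ +-assoc _ _ _ ⟩
    coeff p k + (coeff q k + coeff r k)    ≈⟨ +-congˡ (coeff-+ q r k) ⟨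
    coeff p k + coeff (q +ₚ r) k           ≈⟨ coeff-+ p (q +ₚ r) k ⟨
    coeff (p +ₚ (q +ₚ r)) k                ∎

  +ₚ-identityˡ : ∀ p → [] +ₚ p ≈ₚ p
  +ₚ-identityˡ p = ≈ₚ-refl

  +ₚ-identityʳ : ∀ p → p +ₚ [] ≈ₚ p
  +ₚ-identityʳ p = +ₚ-comm p []

  -ₚ-inverseˡ : ∀ p → -ₚ p +ₚ p ≈ₚ []
  -ₚ-inverseˡ p .at k = begin
    coeff (-ₚ p +ₚ p) k          ≈⟨ coeff-+ (-ₚ p) p k ⟩
    coeff (-ₚ p) k + coeff p k   ≈⟨ +-congʳ (coeff-neg p k) ⟩
    - coeff p k + coeff p k      ≈⟨ -‿inverseˡ _ ⟩
    0#                           ∎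

  -ₚ-inverseʳ : ∀ p → p +ₚ -ₚ p ≈ₚ []
  -ₚ-inverseʳ p = ≈ₚ-trans (+ₚ-comm p (-ₚ p)) (-ₚ-inverseˡ p)

  +ₚ-interchange : ∀ p q r s → (p +ₚ q) +ₚ (r +ₚ s) ≈ₚ (p +ₚ r) +ₚ (q +ₚ s)
  +ₚ-interchange p q r s .at k = begin
    coeff ((p +ₚ q) +ₚ (r +ₚ s)) k
      ≈⟨ coeff-+ (p +ₚ q) (r +ₚ s) k ⟩
    coeff (p +ₚ q) k + coeff (r +ₚ s) k
      ≈⟨ +-cong (coeff-+ p q k) (coeff-+ r s k) ⟩
    (coeff p k + coeff q k) + (coeff r k + coeff s k)
      ≈⟨ interchange _ _ _ _ ⟩
    (coeff p k + coeff r k) + (coeff q k + coeff s k)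
      ≈⟨ +-cong (coeff-+ p r k) (coeff-+ q s k) ⟨
    coeff (p +ₚ r) k + coeff (q +ₚ s) k
      ≈⟨ coeff-+ (p +ₚ r) (q +ₚ s) k ⟨
    coeff ((p +ₚ r) +ₚ (q +ₚ s)) k ∎

  ·-zeroˡ : ∀ {a} p → a ≈ 0# → a · p ≈ₚ []
  ·-zeroˡ {a} p e .at k = trans (coeff-· a p k) (trans (*-congʳ e) (zeroˡ _))

  ·-identityˡ : ∀ p → 1# · p ≈ₚ p
  ·-identityˡ p .at k = trans (coeff-· 1# p k) (*-identityˡ _)

  ·-distribˡ : ∀ a p q → a · (p +ₚ q) ≈ₚ a · p +ₚ a · q
  ·-distribˡ a p q .at k = begin
    coeff (a · (p +ₚ q)) k              ≈⟨ coeff-· a (p +ₚ q) k ⟩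
    a * coeff (p +ₚ q) k                ≈⟨ *-congˡ (coeff-+ p q k) ⟩
    a * (coeff p k + coeff q k)         ≈⟨ distribˡ _ _ _ ⟩
    a * coeff p k + a * coeff q k       ≈⟨ +-cong (coeff-· a p k) (coeff-· a q k) ⟨
    coeff (a · p) k + coeff (a · q) k   ≈⟨ coeff-+ (a · p) (a · q) k ⟨
    coeff (a · p +ₚ a · q) k            ∎

  ·-distribʳ : ∀ a b p → (a + b) · p ≈ₚ a · p +ₚ b · p
  ·-distribʳ a b p .at k = begin
    coeff ((a + b) · p) k               ≈⟨ coeff-· (a + b) p k ⟩
    (a + b) * coeff p k                 ≈⟨ distribʳ _ _ _ ⟩
    a * coeff p k + b * coeff p k       ≈⟨ +-cong (coeff-· a p k) (coeff-· b p k) ⟨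
    coeff (a · p) k + coeff (b · p) k   ≈⟨ coeff-+ (a · p) (b · p) k ⟨
    coeff (a · p +ₚ b · p) k            ∎

  ·-assoc : ∀ a b p → (a * b) · p ≈ₚ a · (b · p)
  ·-assoc a b p .at k = begin
    coeff ((a * b) · p) k    ≈⟨ coeff-· (a * b) p k ⟩
    a * b * coeff p k        ≈⟨ *-assoc _ _ _ ⟩
    a * (b * coeff p k)      ≈⟨ *-congˡ (coeff-· b p k) ⟨
    a * coeff (b · p) k      ≈⟨ coeff-· a (b · p) k ⟨
    coeff (a · (b · p)) k    ∎

  *ₚ-≈[] : ∀ p q → p ≈ₚ [] → p *ₚ q ≈ₚ []
  *ₚ-≈[] []      q e = ≈ₚ-refl
  *ₚ-≈[] (a ∷ p) q e =
    +ₚ-cong (·-zeroˡ q (e .at 0)) (0∷[] (*ₚ-≈[] p q (coeffwise λ k → e .at (suc k))))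

  *ₚ-congˡ : ∀ p {q q′} → q ≈ₚ q′ → p *ₚ q ≈ₚ p *ₚ q′
  *ₚ-congˡ []      e = ≈ₚ-refl
  *ₚ-congˡ (a ∷ p) e = +ₚ-cong (·-cong refl e) (∷-cong refl (*ₚ-congˡ p e))

  *ₚ-congʳ : ∀ p p′ q → p ≈ₚ p′ → p *ₚ q ≈ₚ p′ *ₚ q
  *ₚ-congʳ []      p′       q e = ≈ₚ-sym (*ₚ-≈[] p′ q (≈ₚ-sym e))
  *ₚ-congʳ (a ∷ p) []       q e = *ₚ-≈[] (a ∷ p) q e
  *ₚ-congʳ (a ∷ p) (b ∷ p′) q e =
    +ₚ-cong (·-cong (e .at 0) ≈ₚ-refl) (∷-cong refl (*ₚ-congʳ p p′ q (tail-≈ e)))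

  *ₚ-cong : ∀ {p p′ q q′} → p ≈ₚ p′ → q ≈ₚ q′ → p *ₚ q ≈ₚ p′ *ₚ q′
  *ₚ-cong {p} {p′} {q} e f = ≈ₚ-trans (*ₚ-congʳ p p′ q e) (*ₚ-congˡ p′ f)

  *ₚ-zeroʳ : ∀ p → p *ₚ [] ≈ₚ []
  *ₚ-zeroʳ []      = ≈ₚ-refl
  *ₚ-zeroʳ (a ∷ p) = 0∷[] (*ₚ-zeroʳ p)

  0∷-+ : ∀ p q → (0# ∷ (p +ₚ q)) ≈ₚ (0# ∷ p) +ₚ (0# ∷ q)
  0∷-+ p q = ∷-cong (sym (+-identityˡ 0#)) ≈ₚ-refl

  *ₚ-distribʳ : ∀ r p q → (p +ₚ q) *ₚ r ≈ₚ p *ₚ r +ₚ q *ₚ r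
  *ₚ-distribʳ r []      q       = ≈ₚ-refl
  *ₚ-distribʳ r (a ∷ p) []      = ≈ₚ-sym (+ₚ-identityʳ _)
  *ₚ-distribʳ r (a ∷ p) (b ∷ q) = ≈ₚ-trans
    (+ₚ-cong (·-distribʳ a b r)
      (≈ₚ-trans (∷-cong refl (*ₚ-distribʳ r p q)) (0∷-+ (p *ₚ r) (q *ₚ r))))
    (+ₚ-interchange (a · r) (b · r) (0# ∷ p *ₚ r) (0# ∷ q *ₚ r))

  *ₚ-∷ʳ : ∀ p b q → p *ₚ (b ∷ q) ≈ₚ b · p +ₚ (0# ∷ p *ₚ q)
  *ₚ-∷ʳ []      b q = ≈ₚ-sym (0∷[] ≈ₚ-refl)
  *ₚ-∷ʳ (a ∷ p) b q = ∷-cong (+-congʳ (*-comm a b)) (≈ₚ-trans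
    (+ₚ-cong (≈ₚ-refl {a · q}) (*ₚ-∷ʳ p b q))
    (coeffwise λ k → begin
      coeff (a · q +ₚ (b · p +ₚ (0# ∷ p *ₚ q))) k
        ≈⟨ trans (coeff-+ (a · q) _ k) (+-congˡ (coeff-+ (b · p) _ k)) ⟩
      coeff (a · q) k + (coeff (b · p) k + coeff (0# ∷ p *ₚ q) k)
        ≈⟨ x∙yz≈y∙xz _ _ _ ⟩
      coeff (b · p) k + (coeff (a · q) k + coeff (0# ∷ p *ₚ q) k)
        ≈⟨ trans (coeff-+ (b · p) _ k) (+-congˡ (coeff-+ (a · q) _ k)) ⟨
      coeff (b · p +ₚ (a · q +ₚ (0# ∷ p *ₚ q))) k ∎))

  *ₚ-comm : ∀ p q → p *ₚ q ≈ₚ q *ₚ p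
  *ₚ-comm []      q = ≈ₚ-sym (*ₚ-zeroʳ q)
  *ₚ-comm (a ∷ p) q = ≈ₚ-trans
    (+ₚ-cong (≈ₚ-refl {a · q}) (∷-cong refl (*ₚ-comm p q)))
    (≈ₚ-sym (*ₚ-∷ʳ q a p))

  *ₚ-distribˡ : ∀ r p q → r *ₚ (p +ₚ q) ≈ₚ r *ₚ p +ₚ r *ₚ q
  *ₚ-distribˡ r p q = ≈ₚ-trans (*ₚ-comm r (p +ₚ q)) (≈ₚ-trans (*ₚ-distribʳ r p q)
    (+ₚ-cong (*ₚ-comm p r) (*ₚ-comm q r)))

  ·-*ₚ : ∀ a p q → (a · p) *ₚ q ≈ₚ a · (p *ₚ q)
  ·-*ₚ a []      q = ≈ₚ-refl
  ·-*ₚ a (b ∷ p) q = ≈ₚ-trans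
    (+ₚ-cong (·-assoc a b q) (∷-cong (sym (zeroʳ a)) (·-*ₚ a p q)))
    (≈ₚ-sym (·-distribˡ a (b · q) (0# ∷ p *ₚ q)))

  0∷-*ₚ : ∀ p q → (0# ∷ p) *ₚ q ≈ₚ 0# ∷ (p *ₚ q)
  0∷-*ₚ p q = +ₚ-cong (·-zeroˡ q refl) (≈ₚ-refl {0# ∷ p *ₚ q})

  *ₚ-assoc : ∀ p q r → (p *ₚ q) *ₚ r ≈ₚ p *ₚ (q *ₚ r)
  *ₚ-assoc []      q r = ≈ₚ-refl
  *ₚ-assoc (a ∷ p) q r = ≈ₚ-trans
    (*ₚ-distribʳ r (a · q) (0# ∷ p *ₚ q))
    (+ₚ-cong (·-*ₚ a q r)
      (≈ₚ-trans (0∷-*ₚ (p *ₚ q) r) (∷-cong refl (*ₚ-assoc p q r))))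

  *ₚ-identityˡ : ∀ p → const 1# *ₚ p ≈ₚ p
  *ₚ-identityˡ p = ≈ₚ-trans
    (+ₚ-cong (·-identityˡ p) (0∷[] ≈ₚ-refl)) (+ₚ-identityʳ p)

  *ₚ-identityʳ : ∀ p → p *ₚ const 1# ≈ₚ p
  *ₚ-identityʳ p = ≈ₚ-trans (*ₚ-comm p (const 1#)) (*ₚ-identityˡ p)

  polynomialRing : CommutativeRing c ℓ
  polynomialRing = record
    { Carrier = Poly
    ; _≈_     = _≈ₚ_
    ; _+_     = _+ₚ_
    ; _*_     = _*ₚ_
    ; -_      = -ₚ_
    ; 0#      = []
    ; 1#      = const 1#
    ; isCommutativeRing = record
      { isRing = record
        { +-isAbelianGroup = record
          { isGroup = record
            { isMonoid = record
              { isSemigroup = record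
                { isMagma = record
                  { isEquivalence = record
                    { refl = ≈ₚ-refl ; sym = ≈ₚ-sym ; trans = ≈ₚ-trans }
                  ; ∙-cong = +ₚ-cong
                  }
                ; assoc = +ₚ-assoc
                }
              ; identity = +ₚ-identityˡ , +ₚ-identityʳ
              }
            ; inverse = -ₚ-inverseˡ , -ₚ-inverseʳ
            ; ⁻¹-cong = -ₚ-cong
            }
          ; comm = +ₚ-comm
          }
        ; *-cong     = *ₚ-cong
        ; *-assoc    = *ₚ-assoc
        ; *-identity = *ₚ-identityˡ , *ₚ-identityʳ
        ; distrib    = *ₚ-distribˡ , *ₚ-distribʳ
        }
      ; *-comm = *ₚ-comm
      }
    }

open Polynomial public using (polynomialRing)

-- Degrees take values in ℕ ₋ = ℕ ∪ {-∞}, with deg 0 = ⊥₋ = -∞.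

module Degree (R : CommutativeRing c ℓ)
              (_≟_ : Decidable (CommutativeRing._≈_ R)) where

  open CommutativeRing R using (0#)

  deg : Polynomial.Poly R → ℕ ₋
  deg []      = ⊥₋
  deg (a ∷ p) with deg p | a ≟ 0#
  ... | [ d ] | _     = [ suc d ]
  ... | ⊥₋    | yes _ = ⊥₋
  ... | ⊥₋    | no  _ = [ 0 ]

infixl 6 _+₋_
infixl 7 _*₋_
infix  4 _<₋_ _>₋_

_+₋_ : ℕ ₋ → ℕ ₋ → ℕ ₋
_+₋_ = Maybe.zipWith ℕ._+_

-- Only used for k > 0, hence k *₋ (-∞) = -∞.
_*₋_ : ℕ → ℕ ₋ → ℕ ₋
k *₋ d = Maybe.map (k ℕ.*_) d

_<₋_ _>₋_ : ℕ ₋ → ℕ ₋ → Set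
_<₋_ = Strict._<₋_ ℕ._<_
d >₋ e = e <₋ d

module Factorizations (R : CommutativeRing c ℓ) where

  open CommutativeRing R
  open Primality semiring public using (Irreducible)
  open Divisibility semiring public using (_∣_)

  product : List Carrier → Carrier
  product = foldr _*_ 1#

  record Factorization (f : Carrier) : Set (c ⊔ ℓ) where
    field
      factors     : List Carrier
      irreducible : All Irreducible factors
      product≈f   : f ≈ product factors

    numberOfFactors : ℕ
    numberOfFactors = length factors

  -- f factors into irreducibles, and the number of factors is at most k
  -- whichever factorization is chosen.
  IsProductOfAtMost_Irreducibles : ℕ → Carrier → Set (c ⊔ ℓ)
  IsProductOfAtMost k Irreducibles f =
    Factorization f ×
    (∀ (F : Factorization f) → Factorization.numberOfFactors F ℕ.≤ k)

-- In the presence of excluded middle the apartness of a Heyting field is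
-- the negation of its equality, so K is a field in the usual sense.

module Bivariate (K : HeytingField c ℓ₁ ℓ₂) (em : ExcludedMiddle (c ⊔ ℓ₁ ⊔ ℓ₂)) where

  ring : CommutativeRing c ℓ₁
  ring = HeytingCommutativeRing.commutativeRing (HeytingField.heytingCommutativeRing K)

  K[x] K[x][y] : CommutativeRing c ℓ₁
  K[x]    = polynomialRing ring
  K[x][y] = polynomialRing K[x]

  _≟_ : Decidable (HeytingField._≈_ K)
  x ≟ y = map′ lower lift (em {Lift (c ⊔ ℓ₂) (HeytingField._≈_ K x y)})

  private module K = HeytingField K
  module K[x]    = CommutativeRing K[x]
  module K[x][y] = CommutativeRing K[x][y]

  open Degree ring _≟_ public using (deg)
  open Factorizations K[x][y] public

  fromK : K.Carrier → K[x].Carrier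
  fromK = Polynomial.const ring

  fromK[x] : K[x].Carrier → K[x][y].Carrier
  fromK[x] = Polynomial.const K[x]

  NoNonconstantFactorInK[x] : K[x][y].Carrier → Set (c ⊔ ℓ₁)
  NoNonconstantFactorInK[x] f =
    ∀ (g : K[x].Carrier) → fromK[x] g ∣ f → Σ[ a ∈ K.Carrier ] g K[x].≈ fromK a

  -- a₀ + a₁ y + ⋯ + aₙ yⁿ
  polynomialInY : ∀ {n} → (Fin (suc n) → K[x].Carrier) → K[x][y].Carrier
  polynomialInY = tabulate

{-# OPTIONS --safe #-}

-- Order the monomials yⁱxᵉ by e - i deg aₙ, ties being won by the smaller i.
-- Leading monomials multiply, and the hypothesis on i < j says that the leading
-- monomial of f has y-degree at least j.  A factor g of positive y-degree is not
-- led by a monomial of its full y-degree m: otherwise that monomial would beat a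
-- monomial of lower y-degree, giving it an x-degree above deg aₙ, whereas the
-- leading coefficient of g divides aₙ.  So every irreducible factor contributes at
-- least 1 to the gap n - (y-degree of the leading monomial), which is additive and
-- at most n - j for f.  Reflecting the y-axis (i ↦ -i) exchanges aₙ and a₀ and
-- gives the bound j.

module Submission where

open import Level using (Level; _⊔_; Lift; lift; lower)
open import Algebra.Apartness.Bundles using (HeytingField)
open import Algebra.Bundles using (CommutativeRing)
open import Axiom.ExcludedMiddle using (ExcludedMiddle)
open import Data.Fin.Base using (Fin; zero; toℕ; fromℕ; fromℕ<; _<_; _>_)
import Data.Fin.Properties as Fin
open import Data.Integer.Base as ℤ using (ℤ; +_)
import Data.Integer.Properties as ℤ
open import Data.Integer.Tactic.RingSolver using (solve-∀)
open import Data.List.Base using (List; []; _∷_; _++_; length; upTo; cartesianProduct; tabulate)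
open import Data.List.Membership.Propositional using (_∈_)
open import Data.List.Membership.Propositional.Properties using (∈-upTo⁺; ∈-cartesianProduct⁺)
open import Data.List.Properties using (length-tabulate)
open import Data.List.Relation.Unary.All using (All; []; _∷_)
import Data.List.Relation.Unary.All.Properties as All
open import Data.List.Relation.Unary.Any using (here; there)
open import Data.Nat.Base as ℕ using (ℕ; zero; suc; _≤_; _∸_; _⊓_)
import Data.Nat.Properties as ℕ
open import Data.Product.Base using (_×_; _,_; proj₁; proj₂; ∃-syntax)
open import Data.Product.Relation.Binary.Lex.Strict using (×-Lex; ×-compare; ×-transitive)
open import Data.Sign.Base as Sign using (Sign)
open import Data.Sum.Base as Sum using (_⊎_; inj₁; inj₂)
open import Function.Base using (_∘_)
open import Relation.Binary.Core using (Rel)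
open import Relation.Binary.Definitions
  using (Decidable; Transitive; Trichotomous; tri<; tri≈; tri>; _Respects_)
import Relation.Binary.Construct.Add.Infimum.Strict as Strict
open import Relation.Binary.PropositionalEquality as ≡ using (_≢_; cong; cong₂; subst)
open import Relation.Binary.PropositionalEquality.Core using (_≡_)
open import Relation.Nullary.Construct.Add.Infimum using (⊥₋; [_])
open import Relation.Nullary.Decidable using (yes; no; map′; decidable-stable)
open import Relation.Nullary.Negation using (contradiction)
open import Relation.Nullary.Negation.Core using (¬_)
open import Defs

private
  variable
    c ℓ ℓ₁ ℓ₂ p : Level

-- Coefficients of a product of polynomials.

module Coefficients (R : CommutativeRing c ℓ) where

  open CommutativeRing R
  open Polynomial R
  open import Algebra.Properties.CommutativeSemigroup +-commutativeSemigroup using (x∙yz≈y∙xz)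

  module _ (P : Carrier → Set p) (resp : P Respects _≈_)
           (P-0 : P 0#) (P-+ : ∀ {x y} → P x → P y → P (x + y)) where

    -- The coefficient is a finite sum of the products in the hypothesis, built up by recursion on
    -- `p`. With `P` abstract, the same induction serves for vanishing in the ring and, over K[x],
    -- for vanishing of one fixed x-coefficient.
    coeff-*-closed : ∀ p q s → (∀ i k → i ℕ.+ k ≡ s → P (coeff p i * coeff q k)) →
                     P (coeff (p *ₚ q) s)
    coeff-*-closed []      q s h = P-0
    coeff-*-closed (a ∷ p) q s h =
      resp (sym (coeff-+ (a · q) (0# ∷ p *ₚ q) s))
        (P-+ (resp (sym (coeff-· a q s)) (h 0 s ≡.refl)) (tail s h))
      where
      tail : ∀ s → (∀ i k → i ℕ.+ k ≡ s → P (coeff (a ∷ p) i * coeff q k)) →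
             P (coeff (0# ∷ p *ₚ q) s)
      tail zero    h = P-0
      tail (suc s) h = coeff-*-closed p q s λ i k e → h (suc i) k (cong suc e)

    -- The convolution sum with its `k`-th term set apart: `r` collects all the other terms. This is
    -- how a leading coefficient of a product is recognised as a single product.
    coeff-*-isolated : ∀ p q k l →
      (∀ i j → i ℕ.+ j ≡ k ℕ.+ l → i ≢ k → P (coeff p i * coeff q j)) →
      ∃[ r ] P r × coeff (p *ₚ q) (k ℕ.+ l) ≈ coeff p k * coeff q l + r
    coeff-*-isolated [] q k l h =
      0# , P-0 , sym (trans (+-identityʳ _) (zeroˡ _))
    coeff-*-isolated (a ∷ p) q zero l h =
      _ , rest l h , trans (coeff-+ (a · q) _ l) (+-congʳ (coeff-· a q l))
      where
      rest : ∀ l → (∀ i j → i ℕ.+ j ≡ l → i ≢ 0 → P (coeff (a ∷ p) i * coeff q j)) →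
             P (coeff (0# ∷ p *ₚ q) l)
      rest zero    h = P-0
      rest (suc l) h = coeff-*-closed p q l λ i j e → h (suc i) j (cong suc e) λ ()
    coeff-*-isolated (a ∷ p) q (suc k) l h =
      let r , Pr , eq = coeff-*-isolated p q k l
            λ i j e i≢k → h (suc i) j (cong suc e) (i≢k ∘ ℕ.suc-injective)
      in a * coeff q (suc k ℕ.+ l) + r
       , P-+ (h 0 _ ≡.refl λ ()) Pr
       , trans (coeff-+ (a · q) _ (suc k ℕ.+ l))
           (trans (+-cong (coeff-· a q _) eq) (x∙yz≈y∙xz _ _ _))

  coeff-beyond : ∀ p {k} → length p ℕ.≤ k → coeff p k ≈ 0#
  coeff-beyond []      _           = refl
  coeff-beyond (a ∷ p) (ℕ.s≤s len) = coeff-beyond p len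

-- Monomials, as pairs of y-degree and x-degree, and their orders.

Monomial : Set
Monomial = ℕ × ℕ

infixl 6 _⊕_

_⊕_ : Monomial → Monomial → Monomial
(i , e) ⊕ (k , d) = i ℕ.+ k , e ℕ.+ d

-- Weights are compared lexicographically. Additivity makes the order compatible with multiplication
-- of monomials, and joint injectivity makes it total. Values in ℤ allow the y-axis to be tilted and
-- reflected.
record Weights : Set where
  field
    primary secondary : Monomial → ℤ
    primary-⊕   : ∀ m n → primary (m ⊕ n) ≡ primary m ℤ.+ primary n
    secondary-⊕ : ∀ m n → secondary (m ⊕ n) ≡ secondary m ℤ.+ secondary n
    injective   : ∀ {m n} → primary m ≡ primary n → secondary m ≡ secondary n → m ≡ n

module MonomialOrder (W : Weights) where

  open Weights W

  weight : Monomial → ℤ × ℤ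
  weight m = primary m , secondary m

  infix 4 _<ₗₑₓ_ _⊏_

  _<ₗₑₓ_ : Rel (ℤ × ℤ) _
  _<ₗₑₓ_ = ×-Lex _≡_ ℤ._<_ ℤ._<_

  record _⊏_ (m n : Monomial) : Set where
    constructor lex
    field weight< : weight m <ₗₑₓ weight n

  ⊏-compare : Trichotomous _≡_ _⊏_
  ⊏-compare m n with ×-compare {_<₁_ = ℤ._<_} {_<₂_ = ℤ._<_} ≡.sym ℤ.<-cmp ℤ.<-cmp (weight m) (weight n)
  ... | tri< lt ¬eq ¬gt = tri< (lex lt) (λ { ≡.refl → ¬eq (≡.refl , ≡.refl) }) (¬gt ∘ _⊏_.weight<)
  ... | tri≈ ¬lt eq ¬gt = tri≈ (¬lt ∘ _⊏_.weight<) (injective (proj₁ eq) (proj₂ eq)) (¬gt ∘ _⊏_.weight<)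
  ... | tri> ¬lt ¬eq gt = tri> (¬lt ∘ _⊏_.weight<) (λ { ≡.refl → ¬eq (≡.refl , ≡.refl) }) (lex gt)

  ⊏-irrefl : ∀ {m} → ¬ m ⊏ m
  ⊏-irrefl (lex (inj₁ lt))       = ℤ.<-irrefl ≡.refl lt
  ⊏-irrefl (lex (inj₂ (_ , lt))) = ℤ.<-irrefl ≡.refl lt

  ⊏-trans : Transitive _⊏_
  ⊏-trans (lex k<m) (lex m<n) = lex
    (×-transitive {_<₁_ = ℤ._<_} {_<₂_ = ℤ._<_} ≡.isEquivalence
      (≡.resp₂ ℤ._<_) ℤ.<-trans ℤ.<-trans k<m m<n)

  private
    ⊕-weights : ∀ {m n m′ n′} →
      (primary m ℤ.+ primary n , secondary m ℤ.+ secondary n) <ₗₑₓ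
      (primary m′ ℤ.+ primary n′ , secondary m′ ℤ.+ secondary n′) →
      m ⊕ n ⊏ m′ ⊕ n′
    ⊕-weights {m} {n} {m′} {n′} =
      lex ∘ ≡.subst₂ _<ₗₑₓ_
        (≡.sym (cong₂ _,_ (primary-⊕ m n) (secondary-⊕ m n)))
        (≡.sym (cong₂ _,_ (primary-⊕ m′ n′) (secondary-⊕ m′ n′)))

  ⊕-monoˡ-⊏ : ∀ {m m′} n → m ⊏ m′ → m ⊕ n ⊏ m′ ⊕ n
  ⊕-monoˡ-⊏ n (lex (inj₁ lt)) = ⊕-weights (inj₁ (ℤ.+-monoˡ-< (primary n) lt))
  ⊕-monoˡ-⊏ n (lex (inj₂ (eq , lt))) =
    ⊕-weights (inj₂ (cong (ℤ._+ primary n) eq , ℤ.+-monoˡ-< (secondary n) lt))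

  ⊕-monoʳ-⊏ : ∀ m {n n′} → n ⊏ n′ → m ⊕ n ⊏ m ⊕ n′
  ⊕-monoʳ-⊏ m (lex (inj₁ lt)) = ⊕-weights (inj₁ (ℤ.+-monoʳ-< (primary m) lt))
  ⊕-monoʳ-⊏ m (lex (inj₂ (eq , lt))) =
    ⊕-weights (inj₂ (cong (ℤ._+_ (primary m)) eq , ℤ.+-monoʳ-< (secondary m) lt))

-- Leading monomials over an integral domain.

module Leading (R : CommutativeRing c ℓ)
               (_≟_ : Decidable (CommutativeRing._≈_ R))
               (integral : ∀ {x y} → CommutativeRing._≈_ R (CommutativeRing._*_ R x y) (CommutativeRing.0# R) →
                           CommutativeRing._≈_ R x (CommutativeRing.0# R) ⊎
                           CommutativeRing._≈_ R y (CommutativeRing.0# R))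
               (1≉0 : ¬ CommutativeRing._≈_ R (CommutativeRing.1# R) (CommutativeRing.0# R)) where

  open CommutativeRing R

  private
    R[x] R[x][y] : CommutativeRing c ℓ
    R[x]    = polynomialRing R
    R[x][y] = polynomialRing R[x]
    module R[x]    = CommutativeRing R[x]
    module R[x][y] = CommutativeRing R[x][y]
    module P  = Polynomial R
    module Q  = Polynomial R[x]
    module CP = Coefficients R
    module CQ = Coefficients R[x]

  coeff₂ : R[x][y].Carrier → Monomial → Carrier
  coeff₂ g (i , e) = P.coeff (Q.coeff g i) e

  coeff₂-cong : ∀ {g h} → g R[x][y].≈ h → ∀ m → coeff₂ g m ≈ coeff₂ h m
  coeff₂-cong g≈h (i , e) = P.at (Q.at g≈h i) e

  private
    -- A finite rectangle outside which all coefficients vanish. It may also contain monomials with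
    -- coefficient zero, since lists may carry trailing zeros.
    support : R[x][y].Carrier → List Monomial
    support g = cartesianProduct (upTo (length g)) (upTo (bound g))
      module Support where
      bound : R[x][y].Carrier → ℕ
      bound []      = 0
      bound (a ∷ g) = length a ℕ.⊔ bound g

      beyond-bound : ∀ g i {e} → bound g ℕ.≤ e → coeff₂ g (i , e) ≈ 0#
      beyond-bound []      i       _   = refl
      beyond-bound (a ∷ g) zero    b≤e = CP.coeff-beyond a (ℕ.m⊔n≤o⇒m≤o _ _ b≤e)
      beyond-bound (a ∷ g) (suc i) b≤e = beyond-bound g i (ℕ.m⊔n≤o⇒n≤o (length a) _ b≤e)

    coeff₂≉0⇒∈support : ∀ g {m} → ¬ coeff₂ g m ≈ 0# → m ∈ support g
    coeff₂≉0⇒∈support g {i , e} m≉0 = ∈-cartesianProduct⁺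
      (∈-upTo⁺ (ℕ.≰⇒> λ len≤i → m≉0 (P.at (CQ.coeff-beyond g len≤i) e)))
      (∈-upTo⁺ (ℕ.≰⇒> λ bnd≤e → m≉0 (Support.beyond-bound g g i bnd≤e)))

  nonzero : ∀ g → ¬ g R[x][y].≈ R[x][y].0# → ¬ (∀ m → coeff₂ g m ≈ 0#)
  nonzero g g≉0 all≈0 = g≉0 (Q.coeffwise λ i → P.coeffwise λ e → all≈0 (i , e))

  module _ (W : Weights) where

    open MonomialOrder W

    record LeadsWith (m : Monomial) (g : R[x][y].Carrier) : Set ℓ where
      field
        coeff≉0 : ¬ coeff₂ g m ≈ 0#
        above≈0 : ∀ {n} → m ⊏ n → coeff₂ g n ≈ 0#

    open LeadsWith

    LeadsWith-cong : ∀ {m g h} → g R[x][y].≈ h → LeadsWith m g → LeadsWith m h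
    LeadsWith-cong {m} g≈h lead .coeff≉0 = lead .coeff≉0 ∘ trans (coeff₂-cong g≈h m)
    LeadsWith-cong g≈h lead .above≈0 {n} m⊏n =
      trans (sym (coeff₂-cong g≈h n)) (lead .above≈0 m⊏n)

    LeadsWith-unique : ∀ {m n g} → LeadsWith m g → LeadsWith n g → m ≡ n
    LeadsWith-unique {m} {n} leadₘ leadₙ with ⊏-compare m n
    ... | tri< m⊏n _ _ = contradiction (leadₘ .above≈0 m⊏n) (leadₙ .coeff≉0)
    ... | tri≈ _ m≡n _ = m≡n
    ... | tri> _ _ n⊏m = contradiction (leadₙ .above≈0 n⊏m) (leadₘ .coeff≉0)

    LeadsWith-1 : LeadsWith (0 , 0) R[x][y].1#
    LeadsWith-1 .coeff≉0 = 1≉0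
    LeadsWith-1 .above≈0 {zero  , zero}  lt = contradiction lt ⊏-irrefl
    LeadsWith-1 .above≈0 {zero  , suc e} lt = refl
    LeadsWith-1 .above≈0 {suc i , e}     lt = refl

    -- The order itself has no greatest element; a leading monomial exists because all nonzero
    -- coefficients sit in the finite list `support g`, which `maximum` runs through.
    leading : ∀ g → ¬ g R[x][y].≈ R[x][y].0# → ∃[ m ] LeadsWith m g
    leading g g≉0 with maximum (support g)
      where
      maximum : ∀ ms → (∀ {m} → m ∈ ms → coeff₂ g m ≈ 0#) ⊎
                (∃[ m ] ¬ coeff₂ g m ≈ 0# × ∀ {n} → n ∈ ms → m ⊏ n → coeff₂ g n ≈ 0#)
      maximum [] = inj₁ λ ()
      maximum (m ∷ ms) with coeff₂ g m ≟ 0# | maximum ms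
      ... | yes m≈0 | inj₁ all≈0 = inj₁ λ where
        (here ≡.refl) → m≈0
        (there n∈)    → all≈0 n∈
      ... | yes m≈0 | inj₂ (k , k≉0 , above) = inj₂ (k , k≉0 , λ where
        (here ≡.refl) _  → m≈0
        (there n∈)    lt → above n∈ lt)
      ... | no m≉0 | inj₁ all≈0 = inj₂ (m , m≉0 , λ where
        (here ≡.refl) lt → contradiction lt ⊏-irrefl
        (there n∈)    _  → all≈0 n∈)
      ... | no m≉0 | inj₂ (k , k≉0 , above) with ⊏-compare k m
      ...   | tri< k⊏m _ _ = inj₂ (m , m≉0 , λ where
        (here ≡.refl) lt → contradiction lt ⊏-irrefl
        (there n∈)    lt → above n∈ (⊏-trans k⊏m lt))
      ...   | tri≈ k⊏̸m _ _ = inj₂ (k , k≉0 , λ where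
        (here ≡.refl) lt → contradiction lt k⊏̸m
        (there n∈)    lt → above n∈ lt)
      ...   | tri> k⊏̸m _ _ = inj₂ (k , k≉0 , λ where
        (here ≡.refl) lt → contradiction lt k⊏̸m
        (there n∈)    lt → above n∈ lt)
    ... | inj₁ all≈0 = contradiction
      (λ m → decidable-stable (coeff₂ g m ≟ 0#) λ m≉0 → m≉0 (all≈0 (coeff₂≉0⇒∈support g m≉0)))
      (nonzero g g≉0)
    ... | inj₂ (m , m≉0 , above) = m , record
      { coeff≉0 = m≉0
      ; above≈0 = λ {n} m⊏n → decidable-stable (coeff₂ g n ≟ 0#) λ n≉0 →
          n≉0 (above (coeff₂≉0⇒∈support g n≉0) m⊏n)
      }

    private
      *-≈0 : ∀ {x y} → x ≈ 0# ⊎ y ≈ 0# → x * y ≈ 0#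
      *-≈0 (inj₁ x≈0) = trans (*-congʳ x≈0) (zeroˡ _)
      *-≈0 (inj₂ y≈0) = trans (*-congˡ y≈0) (zeroʳ _)

      +-≈0 : ∀ {x y} → x ≈ 0# → y ≈ 0# → x + y ≈ 0#
      +-≈0 x≈0 y≈0 = trans (+-cong x≈0 y≈0) (+-identityˡ 0#)

      ≈0-resp : (_≈ 0#) Respects _≈_
      ≈0-resp x≈y x≈0 = trans (sym x≈y) x≈0

    -- Only the pair of leading monomials contributes at `m ⊕ n`, and nothing contributes above it.
    -- The product of the two leading coefficients is nonzero by `integral`.
    LeadsWith-* : ∀ {m n g h} → LeadsWith m g → LeadsWith n h → LeadsWith (m ⊕ n) (g R[x][y].* h)
    LeadsWith-* {m@(i , e)} {n@(k , d)} {g} {h} lead-g lead-h = record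
      { coeff≉0 = ≉0
      ; above≈0 = λ {t} → ≈0 t
      }
      where
      -- If neither monomial exceeds its leader, then either both are the leaders or the product
      -- lies strictly below `m ⊕ n`. Both are excluded, so one of them exceeds its leader and has
      -- coefficient zero.
      vanish : ∀ m′ n′ → ¬ m′ ⊕ n′ ⊏ m ⊕ n → ¬ (m′ ≡ m × n′ ≡ n) →
               coeff₂ g m′ * coeff₂ h n′ ≈ 0#
      vanish m′ n′ ¬⊏ ¬≡ with ⊏-compare m′ m | ⊏-compare n′ n
      ... | tri> _ _ m⊏m′ | _             = *-≈0 (inj₁ (lead-g .above≈0 m⊏m′))
      ... | _             | tri> _ _ n⊏n′ = *-≈0 (inj₂ (lead-h .above≈0 n⊏n′))
      ... | tri≈ _ ≡.refl _ | tri≈ _ ≡.refl _ = contradiction (≡.refl , ≡.refl) ¬≡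
      ... | tri≈ _ ≡.refl _ | tri< n′⊏n _ _ = contradiction (⊕-monoʳ-⊏ m n′⊏n) ¬⊏
      ... | tri< m′⊏m _ _ | tri≈ _ ≡.refl _ = contradiction (⊕-monoˡ-⊏ n m′⊏m) ¬⊏
      ... | tri< m′⊏m _ _ | tri< n′⊏n _ _ = contradiction
        (⊏-trans (⊕-monoˡ-⊏ n′ m′⊏m) (⊕-monoʳ-⊏ m n′⊏n)) ¬⊏

      ≈0 : ∀ t → m ⊕ n ⊏ t → coeff₂ (g R[x][y].* h) t ≈ 0#
      ≈0 (s , t) m⊕n⊏ = CQ.coeff-*-closed (λ p → P.coeff p t ≈ 0#)
        (λ p≈q → ≈0-resp (P.at p≈q t)) refl
        (λ {p} {q} p≈0 q≈0 → trans (P.coeff-+ p q t) (+-≈0 p≈0 q≈0))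
        g h s λ i′ k′ i′+k′≡s →
          CP.coeff-*-closed (_≈ 0#) ≈0-resp refl +-≈0 (Q.coeff g i′) (Q.coeff h k′) t λ e′ d′ e′+d′≡t →
            let t≡ = cong₂ _,_ i′+k′≡s e′+d′≡t in
            vanish (i′ , e′) (k′ , d′)
              (λ lt → ⊏-irrefl (⊏-trans m⊕n⊏ (subst (_⊏ m ⊕ n) t≡ lt)))
              (λ { (≡.refl , ≡.refl) → ⊏-irrefl (subst (m ⊕ n ⊏_) (≡.sym t≡) m⊕n⊏) })

      ≉0 : ¬ coeff₂ (g R[x][y].* h) (m ⊕ n) ≈ 0#
      ≉0 gh≈0 =
        -- The term is isolated in two stages: first the pair `i`, `k` of y-degrees, then inside it
        -- the pair `e`, `d` of x-degrees. Both remainders vanish at the monomial in question.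
        let r , r≈0 , eq = CQ.coeff-*-isolated (λ p → P.coeff p (e ℕ.+ d) ≈ 0#)
              (λ p≈q → ≈0-resp (P.at p≈q _)) refl
              (λ {p} {q} p≈0 q≈0 → trans (P.coeff-+ p q _) (+-≈0 p≈0 q≈0))
              g h i k λ i′ k′ i′+k′≡ i′≢i →
                CP.coeff-*-closed (_≈ 0#) ≈0-resp refl +-≈0 (Q.coeff g i′) (Q.coeff h k′) _ λ e′ d′ e′+d′≡ →
                  vanish (i′ , e′) (k′ , d′) (same (cong₂ _,_ i′+k′≡ e′+d′≡)) (i′≢i ∘ cong proj₁ ∘ proj₁)
            r′ , r′≈0 , eq′ = CP.coeff-*-isolated (_≈ 0#) ≈0-resp refl +-≈0
              (Q.coeff g i) (Q.coeff h k) e d λ e′ d′ e′+d′≡ e′≢e →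
                vanish (i , e′) (k , d′) (same (cong (i ℕ.+ k ,_) e′+d′≡)) (e′≢e ∘ cong proj₂ ∘ proj₁)
            lead≈0 : coeff₂ g m * coeff₂ h n ≈ 0#
            lead≈0 = trans (sym (trans (P.at eq (e ℕ.+ d))
              (trans (P.coeff-+ (Q.coeff g i R[x].* Q.coeff h k) r (e ℕ.+ d))
                (trans (+-cong eq′ r≈0)
                  (trans (+-identityʳ _) (trans (+-congˡ r′≈0) (+-identityʳ _))))))) gh≈0
        in either (integral lead≈0)
        where
        same : ∀ {t} → t ≡ m ⊕ n → ¬ t ⊏ m ⊕ n
        same ≡.refl = ⊏-irrefl
        either : ¬ (coeff₂ g m ≈ 0# ⊎ coeff₂ h n ≈ 0#)
        either (inj₁ g≈0) = lead-g .coeff≉0 g≈0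
        either (inj₂ h≈0) = lead-h .coeff≉0 h≈0

-- Degrees in terms of coefficients.

module DegreeProperties (R : CommutativeRing c ℓ) (_≟_ : Decidable (CommutativeRing._≈_ R)) where

  open CommutativeRing R
  open Polynomial R using (Poly; coeff)
  open Degree R _≟_

  record HasDegree (p : Poly) (d : ℕ) : Set ℓ where
    constructor hasDegree
    field
      deg≡  : deg p ≡ [ d ]
      top≉0 : ¬ coeff p d ≈ 0#
      above : ∀ e → d ℕ.< e → coeff p e ≈ 0#

  open HasDegree public

  deg-spec : ∀ p → deg p ≡ ⊥₋ × (∀ e → coeff p e ≈ 0#) ⊎
             ∃[ d ] deg p ≡ [ d ] × ¬ coeff p d ≈ 0# × (∀ e → d ℕ.< e → coeff p e ≈ 0#)
  deg-spec []      = inj₁ (≡.refl , λ _ → refl)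
  deg-spec (a ∷ p) with deg p | deg-spec p | a ≟ 0#
  ... | [ d ] | inj₂ (.d , ≡.refl , d≉0 , above≈0) | _ =
    inj₂ (suc d , ≡.refl , d≉0 , λ { (suc e) (ℕ.s≤s d<e) → above≈0 e d<e })
  ... | ⊥₋ | inj₁ (_ , p≈0) | yes a≈0 =
    inj₁ (≡.refl , λ { zero → a≈0 ; (suc e) → p≈0 e })
  ... | ⊥₋ | inj₁ (_ , p≈0) | no a≉0 =
    inj₂ (0 , ≡.refl , a≉0 , λ { (suc e) _ → p≈0 e })

  ≉0⇒HasDegree : ∀ p → ¬ (∀ e → coeff p e ≈ 0#) → ∃[ d ] HasDegree p d
  ≉0⇒HasDegree p p≉0 with deg-spec p
  ... | inj₁ (_ , p≈0)                  = contradiction p≈0 p≉0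
  ... | inj₂ (d , degₚ , d≉0 , above≈0) = d , hasDegree degₚ d≉0 above≈0

  >₋⇒HasDegree : ∀ p {t} → deg p >₋ t → ∃[ d ] HasDegree p d
  >₋⇒HasDegree p lt with deg-spec p
  ... | inj₁ (degₚ , _)                 = contradiction (subst (_ <₋_) degₚ lt) λ ()
  ... | inj₂ (d , degₚ , d≉0 , above≈0) = d , hasDegree degₚ d≉0 above≈0

-- The outermost and the tilted order, in both directions of the y-axis.

axis : Sign → ℕ → ℤ
axis Sign.+ i = + i
axis Sign.- i = ℤ.- (+ i)

axis-+ : ∀ σ i k → axis σ (i ℕ.+ k) ≡ axis σ i ℤ.+ axis σ k
axis-+ Sign.+ i k = ≡.refl
axis-+ Sign.- i k = ℤ.neg-distrib-+ (+ i) (+ k)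

axis-injective : ∀ σ {i k} → axis σ i ≡ axis σ k → i ≡ k
axis-injective Sign.+ eq = ℤ.+-injective eq
axis-injective Sign.- eq = ℤ.+-injective (ℤ.neg-injective eq)

-- The leading monomial of f in this order is `(n , deg aₙ)` for `+` and `(0 , deg a₀)` for `-`.
outermost : Sign → Weights
outermost σ = record
  { primary     = λ (i , e) → axis σ i
  ; secondary   = λ (i , e) → + e
  ; primary-⊕   = λ (i , _) (k , _) → axis-+ σ i k
  ; secondary-⊕ = λ _ _ → ≡.refl
  ; injective   = λ i≡k e≡d → cong₂ _,_ (axis-injective σ i≡k) (ℤ.+-injective e≡d)
  }

tilt : Sign → ℕ → Monomial → ℤ
tilt σ s (i , e) = + e ℤ.- axis σ i ℤ.* + s

-- The order of the header is σ = + with s = deg aₙ; its reflection is σ = - with s = deg a₀.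
tilted : Sign → ℕ → Weights
tilted σ s = record
  { primary     = tilt σ s
  ; secondary   = λ (i , e) → ℤ.- axis σ i
  ; primary-⊕   = λ (i , e) (k , d) → ≡.trans
      (cong (λ z → + (e ℕ.+ d) ℤ.- z ℤ.* + s) (axis-+ σ i k))
      (expand (+ e) (+ d) (axis σ i) (axis σ k) (+ s))
  ; secondary-⊕ = λ (i , _) (k , _) → ≡.trans
      (cong ℤ.-_ (axis-+ σ i k)) (ℤ.neg-distrib-+ (axis σ i) (axis σ k))
  ; injective   = λ {(i , e)} {(k , d)} → inj i e k d
  }
  where
  expand : ∀ e d x y s → e ℤ.+ d ℤ.- (x ℤ.+ y) ℤ.* s ≡ (e ℤ.- x ℤ.* s) ℤ.+ (d ℤ.- y ℤ.* s)
  expand = solve-∀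
  inj : ∀ i e k d → tilt σ s (i , e) ≡ tilt σ s (k , d) → ℤ.- axis σ i ≡ ℤ.- axis σ k →
        (i , e) ≡ (k , d)
  inj i e k d tilt≡ axis≡ with axis-injective σ {i} {k} (ℤ.neg-injective axis≡)
  ... | ≡.refl = cong (i ,_) (ℤ.+-injective (cancelʳ (ℤ.- (axis σ i ℤ.* + s)) (+ e) (+ d) tilt≡))
    where open import Algebra.Properties.AbelianGroup ℤ.+-0-abelianGroup using () renaming (∙-cancelʳ to cancelʳ)

-- Each step outward along the axis lowers the tilt by `s`. Lying at least one step further out thus
-- costs at least `s`, which an x-degree `e ≤ s` cannot outweigh, even against `d = 0`.
tilt-antimono : ∀ σ {s i k e} d → axis σ i ℤ.< axis σ k → e ℕ.≤ s →
                tilt σ s (k , e) ℤ.≤ tilt σ s (i , d)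
tilt-antimono σ {s} {i} {k} {e} d i<k e≤s = begin
  + e ℤ.- axis σ k ℤ.* + s            ≤⟨ ℤ.+-monoˡ-≤ (ℤ.- (axis σ k ℤ.* + s)) (ℤ.+≤+ e≤s) ⟩
  + s ℤ.- axis σ k ℤ.* + s            ≤⟨ ℤ.+-monoʳ-≤ (+ s) (ℤ.neg-mono-≤
                                           (ℤ.*-monoʳ-≤-nonNeg (+ s) (ℤ.i<j⇒suc[i]≤j i<k))) ⟩
  + s ℤ.- ℤ.suc (axis σ i) ℤ.* + s    ≡⟨ simplify (+ s) (axis σ i) ⟩
  + 0 ℤ.- axis σ i ℤ.* + s            ≤⟨ ℤ.+-monoˡ-≤ (ℤ.- (axis σ i ℤ.* + s)) (ℤ.+≤+ {n = d} ℕ.z≤n) ⟩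
  + d ℤ.- axis σ i ℤ.* + s            ∎
  where
  open ℤ.≤-Reasoning
  simplify : ∀ s x → s ℤ.- (+ 1 ℤ.+ x) ℤ.* s ≡ + 0 ℤ.- x ℤ.* s
  simplify = solve-∀

-- Going `δ` steps outward costs `δ * s`, and the gain in x-degree exceeds this cost. The degree
-- hypotheses on `aⱼ` enter in this form.
tilt-mono : ∀ {s δ e d} x y → y ≡ x ℤ.+ + δ → e ℕ.+ δ ℕ.* s ℕ.< d →
            + e ℤ.- x ℤ.* + s ℤ.< + d ℤ.- y ℤ.* + s
tilt-mono {s} {δ} {e} {d} x .(x ℤ.+ + δ) ≡.refl lt = begin-strict
  + e ℤ.- x ℤ.* + s                                  ≡⟨ shift (+ e) x (+ δ) (+ s) ⟩
  + e ℤ.+ + δ ℤ.* + s ℤ.- (x ℤ.+ + δ) ℤ.* + s        ≡⟨ cong (λ z → + e ℤ.+ z ℤ.- (x ℤ.+ + δ) ℤ.* + s) (ℤ.pos-* δ s) ⟨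
  + (e ℕ.+ δ ℕ.* s) ℤ.- (x ℤ.+ + δ) ℤ.* + s          <⟨ ℤ.+-monoˡ-< (ℤ.- ((x ℤ.+ + δ) ℤ.* + s)) (ℤ.+<+ lt) ⟩
  + d ℤ.- (x ℤ.+ + δ) ℤ.* + s                        ∎
  where
  open ℤ.≤-Reasoning
  shift : ∀ e x δ s → e ℤ.- x ℤ.* s ≡ e ℤ.+ δ ℤ.* s ℤ.- (x ℤ.+ δ) ℤ.* s
  shift = solve-∀

axis-∸ : ∀ {i j} → i ≤ j → + j ≡ + i ℤ.+ + (j ∸ i)
axis-∸ i≤j = cong +_ (≡.sym (ℕ.m+[n∸m]≡n i≤j))

neg-axis-∸ : ∀ {i j} → j ≤ i → ℤ.- (+ j) ≡ ℤ.- (+ i) ℤ.+ + (i ∸ j)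
neg-axis-∸ {i} {j} j≤i = ≡.trans (cancel (+ j) (+ (i ∸ j)))
  (cong (λ z → ℤ.- z ℤ.+ + (i ∸ j)) (≡.sym (axis-∸ j≤i)))
  where
  cancel : ∀ y δ → ℤ.- y ≡ ℤ.- (y ℤ.+ δ) ℤ.+ δ
  cancel = solve-∀

lowerEM : ∀ b → ExcludedMiddle (p ⊔ b) → ExcludedMiddle p
lowerEM b em {P} = map′ lower lift (em {Lift b P})

-- Units and irreducible elements of K[x][y].

module Factors (em : ExcludedMiddle (c ⊔ ℓ₁ ⊔ ℓ₂)) (K : HeytingField c ℓ₁ ℓ₂) where

  open Bivariate K em
  open K[x][y] using (_≈_; _*_; 0#; 1#)
  open import Algebra.Properties.Semiring.Divisibility K[x][y].semiring
    using (∣-trans; x∣ʳyx; ∣ʳ-reflexive; ∣ʳ-respˡ-≈; ∣ʳ-respʳ-≈; _,_)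

  open DegreeProperties ring _≟_ public

  private
    module K = HeytingField K
    module P = Polynomial ring
    module Q = Polynomial K[x]

  x≉0⇒x#0 : ∀ {x} → ¬ x K.≈ K.0# → x K.# K.0#
  x≉0⇒x#0 {x} x≉0 =
    decidable-stable (lowerEM (c ⊔ ℓ₁) em) λ ¬x#0 → x≉0 (proj₁ (K.tight x K.0#) ¬x#0)

  open import Algebra.Apartness.Properties.HeytingCommutativeRing K.heytingCommutativeRing
    using (1#0; x-0≈x; x#0y#0→xy#0)

  1≉0 : ¬ K.1# K.≈ K.0#
  1≉0 1≈0 = proj₂ (K.tight K.1# K.0#) 1≈0 1#0

  integral : ∀ {x y} → x K.* y K.≈ K.0# → x K.≈ K.0# ⊎ y K.≈ K.0#
  integral {x} {y} xy≈0 with x ≟ K.0# | y ≟ K.0#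
  ... | yes x≈0 | _       = inj₁ x≈0
  ... | no  _   | yes y≈0 = inj₂ y≈0
  ... | no  x≉0 | no  y≉0 =
    contradiction (x#0y#0→xy#0 (x≉0⇒x#0 x≉0) (x≉0⇒x#0 y≉0)) (proj₂ (K.tight _ _) xy≈0)

  inverse : ∀ {x} → ¬ x K.≈ K.0# → ∃[ y ] y K.* x K.≈ K.1#
  inverse {x} x≉0 =
    -- Apartness from 0 gives invertibility of the difference `x - 0`, which is then replaced by
    -- `x`.
    let y , y[x-0]≈1 , _ = K.#⇒invertible (x≉0⇒x#0 x≉0)
    in y , K.trans (K.*-congˡ (K.sym (x-0≈x x))) y[x-0]≈1

  open Leading ring _≟_ integral 1≉0 public
  open LeadsWith public

  constant-∣1 : ∀ {x} → ¬ x K.≈ K.0# → fromK[x] (fromK x) ∣ 1#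
  constant-∣1 x≉0 =
    let y , yx≈1 = inverse x≉0
    in fromK[x] (fromK y) , Q.∷-cong
         (K[x].trans (K[x].+-identityʳ _) (P.∷-cong (K.trans (K.+-identityʳ _) yx≈1) P.≈ₚ-refl))
         Q.≈ₚ-refl

  irreducible⊎reducible : ∀ {g} → ¬ g ∣ 1# →
    Irreducible g ⊎ (∃[ p ] ∃[ q ] g ≈ p * q × ¬ p ∣ 1# × ¬ q ∣ 1#)
  irreducible⊎reducible {g} g∤1
    with lowerEM ℓ₂ em {∃[ p ] ∃[ q ] g ≈ p * q × ¬ p ∣ 1# × ¬ q ∣ 1#}
  ... | yes red = inj₂ red
  ... | no ¬red = inj₁ record { p∤1 = g∤1 ; split-∣1 = split }
    where
    split : ∀ {p q} → g ≈ p * q → p ∣ 1# ⊎ q ∣ 1#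
    split {p} {q} g≈pq with lowerEM ℓ₂ em {p ∣ 1#} | lowerEM ℓ₂ em {q ∣ 1#}
    ... | yes p∣1 | _       = inj₁ p∣1
    ... | no  _   | yes q∣1 = inj₂ q∣1
    ... | no  p∤1 | no  q∤1 = contradiction (p , q , g≈pq , p∤1 , q∤1) ¬red

  product-++ : ∀ gs hs → product gs * product hs ≈ product (gs ++ hs)
  product-++ []       hs = K[x][y].*-identityˡ (product hs)
  product-++ (g ∷ gs) hs = K[x][y].trans (K[x][y].*-assoc g (product gs) (product hs))
    (K[x][y].*-congˡ {g} (product-++ gs hs))

  Factorization-* : ∀ {g p q} → g ≈ p * q → Factorization p → Factorization q → Factorization g
  Factorization-* g≈pq P Q = record
    { factors     = factors P ++ factors Q
    ; irreducible = All.++⁺ (irreducible P) (irreducible Q)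
    ; product≈f   = K[x][y].trans g≈pq
        (K[x][y].trans (K[x][y].*-cong (product≈f P) (product≈f Q)) (product-++ (factors P) (factors Q)))
    }
    where open Factorization

  -- Divisors of f.

  module Divisors (f : K[x][y].Carrier) (noFactor : NoNonconstantFactorInK[x] f)
                  (f₀≉0 : ¬ Q.coeff f 0 K[x].≈ K[x].0#) where

    divisor≉0 : ∀ {g} → g ∣ f → ¬ g ≈ 0#
    divisor≉0 (q , qg≈f) g≈0 =
      f₀≉0 (Q.at (K[x][y].trans (K[x][y].sym qg≈f)
        (K[x][y].trans (K[x][y].*-congˡ {q} g≈0) (K[x][y].zeroʳ q))) 0)

    -- A divisor concentrated in a single power of y is an element of K[x], as y does not divide f.
    spread : ∀ {g} → g ∣ f → ¬ g ∣ 1# → ∀ i → ∃[ m ] ¬ coeff₂ g m K.≈ K.0# × proj₁ m ≢ i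
    spread {g} g∣f@(q , qg≈f) g∤1 i = decidable-stable (lowerEM (c ⊔ ℓ₂) em) λ none →
      let zeroOff : ∀ m → proj₁ m ≢ i → coeff₂ g m K.≈ K.0#
          zeroOff m m≢i = decidable-stable (coeff₂ g m ≟ K.0#) λ m≉0 → none (m , m≉0 , m≢i)
      in absurd i zeroOff
      where
      absurd : ∀ i → ¬ (∀ m → proj₁ m ≢ i → coeff₂ g m K.≈ K.0#)
      absurd (suc i) zeroOff = f₀≉0 (K[x].trans (Q.at (K[x][y].sym qg≈f) 0)
        (Coefficients.coeff-*-closed K[x] (K[x]._≈ K[x].0#)
          (λ x≈y x≈0 → K[x].trans (K[x].sym x≈y) x≈0) K[x].refl
          (λ x≈0 y≈0 → K[x].+-cong x≈0 y≈0) q g 0 zeros))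
        where
        zeros : ∀ i k → i ℕ.+ k ≡ 0 → Q.coeff q i K[x].* Q.coeff g k K[x].≈ K[x].0#
        zeros zero .zero ≡.refl = K[x].trans
          (K[x].*-congˡ {Q.coeff q 0} (P.coeffwise λ e → zeroOff (0 , e) λ ())) (K[x].zeroʳ (Q.coeff q 0))
      absurd zero zeroOff = g∤1 (∣ʳ-respˡ-≈ (K[x][y].sym g≈x) (constant-∣1 x≉0))
        where
        g≈g₀ : g ≈ fromK[x] (Q.coeff g 0)
        g≈g₀ = Q.coeffwise λ where
          zero    → K[x].refl
          (suc i) → P.coeffwise λ e → zeroOff (suc i , e) λ ()
        g₀-constant = noFactor (Q.coeff g 0) (∣ʳ-respˡ-≈ g≈g₀ g∣f)
        x = proj₁ g₀-constant
        g≈x : g ≈ fromK[x] (fromK x)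
        g≈x = K[x][y].trans g≈g₀ (Q.∷-cong (proj₂ g₀-constant) Q.≈ₚ-refl)
        x≉0 : ¬ x K.≈ K.0#
        x≉0 x≈0 = divisor≉0 g∣f (K[x][y].trans g≈x
          (Q.coeffwise λ { zero → P.coeffwise λ { zero → x≈0 ; (suc _) → K.refl } ; (suc _) → K[x].refl }))

    leading-⊕ : ∀ W {g q k m n} → q * g ≈ f →
                LeadsWith W k q → LeadsWith W m g → LeadsWith W n f → k ⊕ m ≡ n
    leading-⊕ W qg≈f lead-q lead-g lead-f =
      LeadsWith-unique W (LeadsWith-cong W qg≈f (LeadsWith-* W lead-q lead-g)) lead-f

    nonzeroFactor : ∀ {g q} → q * g ≈ f → ¬ q ≈ 0#
    nonzeroFactor {g} {q} qg≈f = divisor≉0 (g , K[x][y].trans (K[x][y].*-comm g q) qg≈f)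

    -- The gap between the two leading monomials of a divisor, and the bound it gives.

    module _ (σ : Sign) {m s} (lead-f : LeadsWith (outermost σ) (m , s) f) where

      private
        A B : Weights
        A = outermost σ
        B = tilted σ s

      -- Leading monomials multiply, so `e` and the x-degree of the leading monomial of the cofactor
      -- add up to `s`.
      leading-degree≤ : ∀ {g i e} → g ∣ f → LeadsWith A (i , e) g → e ℕ.≤ s
      leading-degree≤ {g} {i} {e} (q , qg≈f) lead-g =
        let (k , d) , lead-q = leading A q (nonzeroFactor qg≈f)
        in subst (e ℕ.≤_) (cong proj₂ (leading-⊕ A qg≈f lead-q lead-g lead-f)) (ℕ.m≤n+m e d)

      axis-≤ : ∀ {g i n} → LeadsWith A i g → ¬ coeff₂ g n K.≈ K.0# → axis σ (proj₁ n) ℤ.≤ axis σ (proj₁ i)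
      axis-≤ lead n≉0 = ℤ.≮⇒≥ λ lt → n≉0 (lead .above≈0 (MonomialOrder.lex (inj₁ lt)))

      -- If both leading monomials had the same y-degree, `spread` would supply a monomial of `g`
      -- strictly further inside, and by `tilt-antimono` that monomial would lie above the leader in
      -- the order `B`.
      tilted-inside : ∀ {g m l} → g ∣ f → ¬ g ∣ 1# → LeadsWith A m g → LeadsWith B l g →
                      axis σ (proj₁ l) ℤ.< axis σ (proj₁ m)
      tilted-inside {g} {i , d} {l , e} g∣f g∤1 leadA leadB =
        ℤ.≤∧≢⇒< (axis-≤ leadA (leadB .coeff≉0)) (l≢i ∘ axis-injective σ)
        where
        l≢i : l ≢ i
        l≢i ≡.refl =
          let (k , t) , kt≉0 , k≢i = spread g∣f g∤1 i
              k<i = ℤ.≤∧≢⇒< (axis-≤ leadA kt≉0) (k≢i ∘ axis-injective σ)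
              -- In the order `A`, the leader `(i , d)` has the greatest x-degree among the
              -- monomials of `g` with y-degree `i`.
              e≤d = ℕ.≮⇒≥ λ d<e → leadB .coeff≉0 (leadA .above≈0
                      (MonomialOrder.lex (inj₂ (≡.refl , ℤ.+<+ d<e))))
              e≤s = ℕ.≤-trans e≤d (leading-degree≤ g∣f leadA)
          -- The two tilts may agree, for instance when `e` is `s`, `t` is 0 and `k` is one step
          -- inside `i`; the secondary weight then decides in favour of `(k , t)`.
          in kt≉0 (leadB .above≈0 (MonomialOrder.lex (lexIntro (tilt-antimono σ t k<i e≤s) (ℤ.neg-mono-< k<i))))
          where
          lexIntro : ∀ {x x′ y y′ : ℤ} → x ℤ.≤ x′ → y ℤ.< y′ → x ℤ.< x′ ⊎ (x ≡ x′ × y ℤ.< y′)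
          lexIntro {x} {x′} x≤x′ y<y′ with x ℤ.≟ x′
          ... | yes x≡x′ = inj₂ (x≡x′ , y<y′)
          ... | no  x≢x′ = inj₁ (ℤ.≤∧≢⇒< x≤x′ x≢x′)

      -- Both leading monomials are additive over the product, and each irreducible factor adds at
      -- least 1 to the gap by `tilted-inside`. Divisibility of f is carried along because that
      -- lemma speaks of divisors of f.
      product-gap : ∀ gs → All Irreducible gs → product gs ∣ f →
        ∃[ i ] ∃[ l ] LeadsWith A i (product gs) × LeadsWith B l (product gs) ×
          axis σ (proj₁ l) ℤ.+ + length gs ℤ.≤ axis σ (proj₁ i)
      product-gap [] [] _ =
        (0 , 0) , (0 , 0) , LeadsWith-1 A , LeadsWith-1 B ,
        ℤ.≤-reflexive (ℤ.+-identityʳ (axis σ 0))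
      product-gap (g ∷ gs) (irr ∷ irrs) ∣f =
        let g∣f   = ∣-trans (∣ʳ-respʳ-≈ (K[x][y].*-comm (product gs) g) (x∣ʳyx g (product gs))) ∣f
            Πgs∣f = ∣-trans (x∣ʳyx (product gs) g) ∣f
            i , lead-i = leading A g (divisor≉0 g∣f)
            l , lead-l = leading B g (divisor≉0 g∣f)
            i′ , l′ , lead-i′ , lead-l′ , gap = product-gap gs irrs Πgs∣f
            g-gap = ℤ.i<j⇒suc[i]≤j (tilted-inside g∣f (Irreducible.p∤1 irr) lead-i lead-l)
        in i ⊕ i′ , l ⊕ l′ , LeadsWith-* A lead-i lead-i′ , LeadsWith-* B lead-l lead-l′ ,
           add (proj₁ i) (proj₁ i′) (proj₁ l) (proj₁ l′) (length gs) g-gap gap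
        where
        add : ∀ i i′ l l′ n → ℤ.suc (axis σ l) ℤ.≤ axis σ i → axis σ l′ ℤ.+ + n ℤ.≤ axis σ i′ →
              axis σ (l ℕ.+ l′) ℤ.+ + suc n ℤ.≤ axis σ (i ℕ.+ i′)
        add i i′ l l′ n g-gap gap = begin
          axis σ (l ℕ.+ l′) ℤ.+ + suc n                        ≡⟨ cong (ℤ._+ + suc n) (axis-+ σ l l′) ⟩
          axis σ l ℤ.+ axis σ l′ ℤ.+ (+ 1 ℤ.+ + n)             ≡⟨ rearrange (axis σ l) (axis σ l′) (+ n) ⟩
          (+ 1 ℤ.+ axis σ l) ℤ.+ (axis σ l′ ℤ.+ + n)           ≤⟨ ℤ.+-mono-≤ g-gap gap ⟩
          axis σ i ℤ.+ axis σ i′                               ≡⟨ axis-+ σ i i′ ⟨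
          axis σ (i ℕ.+ i′)                                    ∎
          where
          open ℤ.≤-Reasoning
          rearrange : ∀ x y n → x ℤ.+ y ℤ.+ (+ 1 ℤ.+ n) ≡ (+ 1 ℤ.+ x) ℤ.+ (y ℤ.+ n)
          rearrange = solve-∀

      -- The gap of f is at least the number of factors. Since `j` beats every monomial of f lying
      -- strictly inside it, the tilted leader of f is at least as far out as `j`, which bounds the
      -- gap from above.
      numberOfFactors-bound : ∀ {j} → ¬ coeff₂ f j K.≈ K.0# →
        (∀ n → ¬ coeff₂ f n K.≈ K.0# → axis σ (proj₁ n) ℤ.< axis σ (proj₁ j) →
          tilt σ s n ℤ.< tilt σ s j) →
        (F : Factorization f) →
        axis σ (proj₁ j) ℤ.+ + Factorization.numberOfFactors F ℤ.≤ axis σ m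
      numberOfFactors-bound {j} j≉0 dominant F =
        let open Factorization F
            i , l , lead-i , lead-l , gap =
              product-gap factors irreducible (1# , K[x][y].trans (K[x][y].*-identityˡ _) (K[x][y].sym product≈f))
            lead-iᶠ = LeadsWith-cong A (K[x][y].sym product≈f) lead-i
            lead-lᶠ = LeadsWith-cong B (K[x][y].sym product≈f) lead-l
            -- A leader `l` strictly inside `j` would have smaller tilt than `j`, forcing the
            -- coefficient at `j` to vanish.
            j≤l = ℤ.≮⇒≥ λ l<j → j≉0 (lead-lᶠ .above≈0
                    (MonomialOrder.lex (inj₁ (dominant l (lead-lᶠ .coeff≉0) l<j))))
        in subst (λ k → axis σ (proj₁ j) ℤ.+ + numberOfFactors ℤ.≤ axis σ (proj₁ k))
             (LeadsWith-unique A lead-iᶠ lead-f)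
             (ℤ.≤-trans (ℤ.+-monoˡ-≤ (+ numberOfFactors) j≤l) gap)

    -- Existence of a factorization.

    private
      Top : Weights
      Top = outermost Sign.+

    -- By `spread`, some monomial of `g` has a y-degree other than the highest one, hence a smaller
    -- one.
    nonunit-degree : ∀ {g m} → g ∣ f → ¬ g ∣ 1# → LeadsWith Top m g → 0 ℕ.< proj₁ m
    nonunit-degree {g} {m} g∣f g∤1 lead =
      let n , n≉0 , n≢m = spread g∣f g∤1 (proj₁ m)
          n≤m = ℕ.≮⇒≥ λ m<n → n≉0 (lead .above≈0 (MonomialOrder.lex (inj₁ (ℤ.+<+ m<n))))
      in ℕ.≤-<-trans ℕ.z≤n (ℕ.≤∧≢⇒< n≤m n≢m)

    -- Induction on a bound for the y-degree. In a splitting into nonunits the y-degrees add up and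
    -- are both positive, so each of them is at most `k` when the sum is at most `suc k`.
    factorize : ∀ k {g m} → g ∣ f → ¬ g ∣ 1# → LeadsWith Top m g → proj₁ m ℕ.≤ k → Factorization g
    factorize zero g∣f g∤1 lead m≤0 =
      contradiction (nonunit-degree g∣f g∤1 lead) (ℕ.≤⇒≯ m≤0)
    factorize (suc k) {g} {m} g∣f g∤1 lead m≤1+k = Sum.[ single , split ] (irreducible⊎reducible g∤1)
      where
      single : Irreducible g → Factorization g
      single irr = record
        { factors     = g ∷ []
        ; irreducible = irr ∷ []
        ; product≈f   = K[x][y].sym (K[x][y].*-identityʳ g)
        }
      split : (∃[ p ] ∃[ q ] g ≈ p * q × ¬ p ∣ 1# × ¬ q ∣ 1#) → Factorization g
      split (p , q , g≈pq , p∤1 , q∤1) =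
        let p∣f = ∣-trans (q , K[x][y].trans (K[x][y].*-comm q p) (K[x][y].sym g≈pq)) g∣f
            q∣f = ∣-trans (p , K[x][y].sym g≈pq) g∣f
            (i , _) , lead-p = leading Top p (divisor≉0 p∣f)
            (l , _) , lead-q = leading Top q (divisor≉0 q∣f)
            i+l≡m = cong proj₁ (LeadsWith-unique Top
              (LeadsWith-cong Top (K[x][y].sym g≈pq) (LeadsWith-* Top lead-p lead-q)) lead)
            i+l≤1+k = subst (ℕ._≤ suc k) (≡.sym i+l≡m) m≤1+k
            i>0 = nonunit-degree p∣f p∤1 lead-p
            l>0 = nonunit-degree q∣f q∤1 lead-q
        in Factorization-* g≈pq
             (factorize k p∣f p∤1 lead-p (ℕ.s≤s⁻¹ (ℕ.<-≤-trans (ℕ.m<m+n i l>0) i+l≤1+k)))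
             (factorize k q∣f q∤1 lead-q (ℕ.s≤s⁻¹ (ℕ.<-≤-trans (ℕ.m<n+m l i>0) i+l≤1+k)))

  Irreducible-resp : ∀ {g h} → g ≈ h → Irreducible g → Irreducible h
  Irreducible-resp g≈h irr = record
    { p∤1      = Irreducible.p∤1 irr ∘ ∣ʳ-respˡ-≈ (K[x][y].sym g≈h)
    ; split-∣1 = λ h≈xy → Irreducible.split-∣1 irr (K[x][y].trans g≈h h≈xy)
    }

  -- The empty product is a unit, so exactly one factor remains, and it equals `g`.
  singleFactor⇒Irreducible : ∀ {g} → ¬ g ∣ 1# → (F : Factorization g) →
                             Factorization.numberOfFactors F ≤ 1 → Irreducible g
  singleFactor⇒Irreducible g∤1 record { factors = [] ; product≈f = g≈1 } _ =
    contradiction (∣ʳ-reflexive g≈1) g∤1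
  singleFactor⇒Irreducible g∤1 record { factors = h ∷ [] ; irreducible = irr ∷ [] ; product≈f = g≈h1 } _ =
    Irreducible-resp (K[x][y].sym (K[x][y].trans g≈h1 (K[x][y].*-identityʳ h))) irr
  singleFactor⇒Irreducible g∤1 record { factors = _ ∷ _ ∷ _ } (ℕ.s≤s ())

  -- The polynomial f in terms of its coefficients `a`.

  coeff-tabulate : ∀ {n} (a : Fin n → K[x].Carrier) i → Q.coeff (tabulate a) (toℕ i) ≡ a i
  coeff-tabulate a zero        = ≡.refl
  coeff-tabulate a (Fin.suc i) = coeff-tabulate (a ∘ Fin.suc) i

  coeff-tabulate-beyond : ∀ {n} (a : Fin n → K[x].Carrier) {k} → n ≤ k →
                          Q.coeff (tabulate a) k K[x].≈ K[x].0#
  coeff-tabulate-beyond a n≤k =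
    Coefficients.coeff-beyond K[x] (tabulate a) (subst (_≤ _) (≡.sym (length-tabulate a)) n≤k)

  coeff-tabulate≉0 : ∀ {n} (a : Fin n → K[x].Carrier) k e → ¬ coeff₂ (tabulate a) (k , e) K.≈ K.0# →
                     ∃[ i ] toℕ i ≡ k × ¬ P.coeff (a i) e K.≈ K.0#
  coeff-tabulate≉0 {n} a k e ≉0 with k ℕ.<? n
  ... | no k≮n  = contradiction (P.at (coeff-tabulate-beyond a (ℕ.≮⇒≥ k≮n)) e) ≉0
  ... | yes k<n = fromℕ< k<n , Fin.toℕ-fromℕ< k<n , λ ≈0 → ≉0 (subst
    (λ p → P.coeff p e K.≈ K.0#)
    (≡.trans (≡.sym (coeff-tabulate a (fromℕ< k<n))) (cong (Q.coeff (tabulate a)) (Fin.toℕ-fromℕ< k<n))) ≈0)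

  module _ {n} (a : Fin (suc n) → K[x].Carrier) where

    private
      f : K[x][y].Carrier
      f = polynomialInY a

    leads-top : ∀ {d} → HasDegree (a (fromℕ n)) d → LeadsWith (outermost Sign.+) (n , d) f
    leads-top {d} (hasDegree _ d≉0 above≈0) = record
      { coeff≉0 = λ ≈0 → d≉0 (subst (λ p → P.coeff p d K.≈ K.0#) coeff-n ≈0)
      ; above≈0 = λ { {k , e} (MonomialOrder.lex (inj₁ (ℤ.+<+ n<k))) → P.at (coeff-tabulate-beyond a n<k) e
                    ; {k , e} (MonomialOrder.lex (inj₂ (≡.refl , ℤ.+<+ d<e))) →
                        subst (λ p → P.coeff p e K.≈ K.0#) (≡.sym coeff-n) (above≈0 e d<e) }
      }
      where
      coeff-n : Q.coeff f n ≡ a (fromℕ n)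
      coeff-n = ≡.trans (cong (Q.coeff f) (≡.sym (Fin.toℕ-fromℕ n))) (coeff-tabulate a (fromℕ n))

    leads-bottom : ∀ {d} → HasDegree (a zero) d → LeadsWith (outermost Sign.-) (0 , d) f
    leads-bottom {d} (hasDegree _ d≉0 above≈0) = record
      { coeff≉0 = d≉0
      ; above≈0 = λ { {zero , e} (MonomialOrder.lex (inj₁ (ℤ.+<+ ())))
                    ; {zero , e} (MonomialOrder.lex (inj₂ (_ , ℤ.+<+ d<e))) → above≈0 e d<e
                    ; {suc k , e} (MonomialOrder.lex (inj₁ ()))
                    ; {suc k , e} (MonomialOrder.lex (inj₂ (() , _))) }
      }

    -- Leading y-degrees add, so a cofactor with product 1 would give `k + n ≡ 0`.
    f∤1 : ∀ {d} → LeadsWith (outermost Sign.+) (n , d) f → 0 ℕ.< n → ¬ f ∣ 1#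
    f∤1 {d} lead n>0 (q , qf≈1) =
      let W = outermost Sign.+
          (k , _) , lead-q = leading W q λ q≈0 → 1≉0 (P.at (Q.at (K[x][y].trans (K[x][y].sym qf≈1)
            (K[x][y].trans (K[x][y].*-congʳ {f} q≈0) (K[x][y].zeroˡ f))) 0) 0)
          k+n≡0 = cong proj₁ (LeadsWith-unique W (LeadsWith-cong W qf≈1 (LeadsWith-* W lead-q lead)) (LeadsWith-1 W))
      in contradiction (ℕ.m+n≡0⇒n≡0 k k+n≡0) (ℕ.>⇒≢ n>0)

    -- Applied with l = n, k = j ∸ i for σ = + and with l = 0, k = i ∸ j for σ = -.
    dominates : ∀ σ {i j l e d k s} → ¬ P.coeff (a i) e K.≈ K.0# →
                HasDegree (a j) d → HasDegree (a l) s →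
                axis σ (toℕ j) ≡ axis σ (toℕ i) ℤ.+ + k →
                deg (a j) >₋ deg (a i) +₋ k *₋ deg (a l) →
                tilt σ s (toℕ i , e) ℤ.< tilt σ s (toℕ j , d)
    dominates σ {i} {j} {k = k} {s} e≉0 hasⱼ hasₗ axis≡ hyp =
      let dᵢ , hasᵢ = ≉0⇒HasDegree (a i) λ aᵢ≈0 → e≉0 (aᵢ≈0 _)
      in tilt-mono (axis σ (toℕ i)) (axis σ (toℕ j)) axis≡
        (ℕ.≤-<-trans (ℕ.+-monoˡ-≤ (k ℕ.* s) (ℕ.≮⇒≥ λ dᵢ<e → e≉0 (above hasᵢ _ dᵢ<e)))
          (Strict.[<]-injective ℕ._<_
            (≡.subst₂ _>₋_ (deg≡ hasⱼ) (cong₂ (λ x y → x +₋ k *₋ y) (deg≡ hasᵢ) (deg≡ hasₗ)) hyp)))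

-- The bounds `n ∸ j` and `j` from the two directions of the y-axis, and irreducibility at the ends.

theorem8 :
    ∀ {c ℓ₁ ℓ₂ : Level} (em : ExcludedMiddle (c ⊔ ℓ₁ ⊔ ℓ₂)) (K : HeytingField c ℓ₁ ℓ₂) →
    let open Bivariate K em in
    (n : ℕ) → 2 ≤ n →
    (a : Fin (suc n) → K[x].Carrier) →
    let aₙ = a (fromℕ n)
        a₀ = a zero
        f  = polynomialInY a
    in
    ¬ (a₀ K[x].* aₙ K[x].≈ K[x].0#) →
    NoNonconstantFactorInK[x] f →
    (j : Fin (suc n)) → 1 ≤ toℕ j → toℕ j ≤ n ∸ 1 →
    (∀ i → i < j → deg (a j) >₋ deg (a i) +₋ (toℕ j ∸ toℕ i) *₋ deg aₙ) →
    (∀ i → i > j → deg (a j) >₋ deg (a i) +₋ (toℕ i ∸ toℕ j) *₋ deg a₀) →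
    IsProductOfAtMost (toℕ j ⊓ (n ∸ toℕ j)) Irreducibles f ×
    (toℕ j ≡ 1 ⊎ toℕ j ≡ n ∸ 1 → Irreducible f)
theorem8 em K n 2≤n a a₀aₙ≉0 noFactor j 1≤j j≤n-1 left right =
  (factorization , bound) , irreducible
  where
  open Bivariate K em
  open Factors em K
  open import Algebra.Properties.Semiring.Divisibility K[x][y].semiring using (∣ʳ-refl)

  module K = HeytingField K
  module P = Polynomial ring

  degree₀ : ∃[ d ] HasDegree (a zero) d
  degree₀ = ≉0⇒HasDegree (a zero) λ a₀≈0 → a₀aₙ≉0 (K[x].trans
    (K[x].*-congʳ {a (fromℕ n)} {a zero} {K[x].0#} (P.coeffwise a₀≈0)) (K[x].zeroˡ (a (fromℕ n))))

  degreeₙ : ∃[ d ] HasDegree (a (fromℕ n)) d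
  degreeₙ = ≉0⇒HasDegree (a (fromℕ n)) λ aₙ≈0 → a₀aₙ≉0 (K[x].trans
    (K[x].*-congˡ {a zero} {a (fromℕ n)} {K[x].0#} (P.coeffwise aₙ≈0)) (K[x].zeroʳ (a zero)))

  degreeⱼ : ∃[ d ] HasDegree (a j) d
  -- A degree strictly above anything is not -∞; the index 0 is a valid instance since `1 ≤ j`.
  degreeⱼ = >₋⇒HasDegree (a j) (left zero 1≤j)

  d₀ = proj₁ degree₀
  dₙ = proj₁ degreeₙ
  dⱼ = proj₁ degreeⱼ
  has₀ = proj₂ degree₀
  hasₙ = proj₂ degreeₙ
  hasⱼ = proj₂ degreeⱼ

  f = polynomialInY a
  top    = leads-top a hasₙ
  bottom = leads-bottom a has₀
  nonunit = f∤1 a top (ℕ.<-trans ℕ.z<s 2≤n)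

  f₀≉0 : ¬ a zero K[x].≈ K[x].0#
  f₀≉0 a₀≈0 = top≉0 has₀ (P.at a₀≈0 d₀)

  open Divisors f noFactor f₀≉0

  factorization : Factorization f
  factorization = factorize n ∣ʳ-refl nonunit top ℕ.≤-refl

  j≉0 : ¬ coeff₂ f (toℕ j , dⱼ) K.≈ K.0#
  j≉0 ≈0 = top≉0 hasⱼ (subst (λ p → P.coeff p dⱼ K.≈ K.0#) (coeff-tabulate a j) ≈0)

  left-dominant : ∀ m → ¬ coeff₂ f m K.≈ K.0# → + proj₁ m ℤ.< + toℕ j →
                  tilt Sign.+ dₙ m ℤ.< tilt Sign.+ dₙ (toℕ j , dⱼ)
  left-dominant (k , e) m≉0 (ℤ.+<+ k<j) with coeff-tabulate≉0 a k e m≉0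
  ... | i , ≡.refl , e≉0 = dominates a Sign.+ {i} {j} e≉0 hasⱼ hasₙ (axis-∸ (ℕ.<⇒≤ k<j)) (left i k<j)

  right-dominant : ∀ m → ¬ coeff₂ f m K.≈ K.0# → ℤ.- (+ proj₁ m) ℤ.< ℤ.- (+ toℕ j) →
                   tilt Sign.- d₀ m ℤ.< tilt Sign.- d₀ (toℕ j , dⱼ)
  right-dominant (k , e) m≉0 -k<-j with coeff-tabulate≉0 a k e m≉0
  ... | i , ≡.refl , e≉0 =
    let j<i = ℤ.drop‿+<+ (ℤ.neg-cancel-< -k<-j)
    in dominates a Sign.- {i} {j} e≉0 hasⱼ has₀ (neg-axis-∸ (ℕ.<⇒≤ j<i)) (right i j<i)

  bound : (F : Factorization f) → Factorization.numberOfFactors F ≤ toℕ j ⊓ (n ∸ toℕ j)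
  bound F = ℕ.⊓-glb N≤j N≤n∸j
    where
    N = Factorization.numberOfFactors F
    N≤n∸j : N ≤ n ∸ toℕ j
    N≤n∸j = ℕ.m+n≤o⇒m≤o∸n N (subst (_≤ n) (ℕ.+-comm (toℕ j) N)
      (ℤ.drop‿+≤+ (numberOfFactors-bound Sign.+ top j≉0 left-dominant F)))
    N≤j : N ≤ toℕ j
    -- In the reflected direction the bound reads `- j + N ≤ - 0`; adding `j` to both sides gives
    -- the claim.
    N≤j = ℤ.drop‿+≤+ (≡.subst₂ ℤ._≤_ (cancel (+ toℕ j) (+ N)) (ℤ.+-identityʳ (+ toℕ j))
      (ℤ.+-monoʳ-≤ (+ toℕ j) (numberOfFactors-bound Sign.- bottom j≉0 right-dominant F)))
      where
      cancel : ∀ x y → x ℤ.+ (ℤ.- x ℤ.+ y) ≡ y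
      cancel = solve-∀

  irreducible : toℕ j ≡ 1 ⊎ toℕ j ≡ n ∸ 1 → Irreducible f
  irreducible j≡ = singleFactor⇒Irreducible nonunit factorization
    (ℕ.≤-trans (bound factorization) (min≤1 j≡))
    where
    min≤1 : toℕ j ≡ 1 ⊎ toℕ j ≡ n ∸ 1 → toℕ j ⊓ (n ∸ toℕ j) ≤ 1
    min≤1 (inj₁ j≡1)   = ℕ.≤-trans (ℕ.m⊓n≤m _ _) (ℕ.≤-reflexive j≡1)
    -- Here `n ∸ (n ∸ 1)` is 1, since `1 ≤ n` makes the truncated subtraction exact.
    min≤1 (inj₂ j≡n-1) = ℕ.≤-trans (ℕ.m⊓n≤n (toℕ j) _) (ℕ.≤-reflexive
      (≡.trans (cong (n ∸_) j≡n-1) (ℕ.m∸[m∸n]≡n (ℕ.<⇒≤ 2≤n))))
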